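{- Let $n,q\in\mathbb{N}$ with $n\geqslant q+1$. Then the horizontal player $\mathcal{H}$ has a winning strategy for the $q$-double-response game on $S_{\infty\times n}$.
   Context: $S_{\infty\times n}$ is the infinite subgraph of the square lattice $\Lambda$ (on $\mathbb{Z}^2$, edges between points at Euclidean distance $1$) induced by $\{(x,y):x\in\mathbb{Z},y\in[n]\}$. The dual lattice $\Lambda^*$ has vertex set $\mathbb{Z}^2+(0.5,0.5)$ with edges between points at distance $1$; the dual $e^*$ of an edge $e$ is the dual edge with the same midpoint. A top-bottom crossing dual path is a path in $\Lambda^*$ all of whose dual edges are duals of edges of $S_{\infty\times n}$, joining a dual vertex with second coordinate $0.5$ to a dual vertex with second coordinate $n+0.5$. The $q$-double-response game is played by a vertical player $\mathcal{V}$ and a horizontal player $\mathcal{H}$ on the edges of $S_{\infty\times n}$, with $\mathcal{V}$ moving first: on each turn $t$, $\mathcal{V}$ chooses an integer $r_t\in[q]$ and claims $r_t$ as-yet unclaimed edges, and then $\mathcal{H}$ claims $2r_t$ as-yet unclaimed edges. $\mathcal{V}$ wins if at some point the duals of his claimed edges contain a top-bottom crossing dual path; $\mathcal{H}$ wins if this never happens. -}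

module Defs where

open import Data.Nat using (ℕ; zero; suc; _≤_; _*_)
open import Data.Integer as ℤ using (ℤ; +_; _-_; 1ℤ; 0ℤ)
open import Data.Product using (Σ; ∃; _×_; _,_; proj₁; proj₂)
open import Data.Sum using (_⊎_)
open import Data.Maybe using (Maybe; just)
open import Data.List using (List; []; _∷_; _++_; length; head; last; concat; map)
open import Data.List.Membership.Propositional using (_∈_; _∉_)
open import Data.List.Relation.Unary.All using (All)
open import Data.List.Relation.Unary.Unique.Propositional using (Unique)
open import Data.List.Relation.Unary.Linked using (Linked)
open import Relation.Binary.PropositionalEquality using (_≡_)
open import Relation.Nullary using (¬_)

-- Edges of the square lattice Λ that may lie in S_{∞×n}.
-- Vertices are (x , y) with x : ℤ, y : ℕ.
--   hor x y : the edge (x , y) — (x + 1 , y)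
--   ver x y : the edge (x , y) — (x , y + 1)
data Edge : Set where
  hor : ℤ → ℕ → Edge
  ver : ℤ → ℕ → Edge

ValidEdge : ℕ → Edge → Set
ValidEdge n (hor x y) = (1 ≤ y) × (y ≤ n)
ValidEdge n (ver x y) = (1 ≤ y) × (suc y ≤ n)

-- Dual lattice Λ*: the pair (a , b) : ℤ × ℤ encodes the dual vertex
-- (a + 0.5 , b + 0.5).
DualVertex : Set
DualVertex = ℤ × ℤ

-- Endpoints of the dual edge e* (same midpoint as e).
--   (hor x y)* joins (x+½ , y-½) and (x+½ , y+½)
--   (ver x y)* joins (x-½ , y+½) and (x+½ , y+½)
dualEnds : Edge → DualVertex × DualVertex
dualEnds (hor x y) = ((x , + y - 1ℤ) , (x , + y))
dualEnds (ver x y) = ((x - 1ℤ , + y) , (x , + y))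

DualAdj : List Edge → DualVertex → DualVertex → Set
DualAdj E u v = Σ Edge λ e → e ∈ E ×
  ((dualEnds e ≡ (u , v)) ⊎ (dualEnds e ≡ (v , u)))

Crossing : ℕ → List Edge → Set
Crossing n E = Σ (List DualVertex) λ ps →
  Linked (DualAdj E) ps × Unique ps ×
  (∃ λ u → head ps ≡ just u × proj₂ u ≡ 0ℤ) ×
  (∃ λ w → last ps ≡ just w × proj₂ w ≡ + n)

-- The q-double-response game.
-- A history is the list of completed turns (V's edges , H's edges).
History : Set
History = List (List Edge × List Edge)

claimed : History → List Edge
claimed h = concat (map (λ t → proj₁ t ++ proj₂ t) h)

claimedV : History → List Edge
claimedV h = concat (map proj₁ h)

FreshEdges : ℕ → List Edge → List Edge → Set
FreshEdges n used m = All (ValidEdge n) m × Unique m × All (λ e → e ∉ used) m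

LegalV : ℕ → ℕ → History → List Edge → Set
LegalV n q h m = (1 ≤ length m) × (length m ≤ q) × FreshEdges n (claimed h) m

LegalH : ℕ → History → List Edge → List Edge → Set
LegalH n h m m' = (length m' ≡ 2 * length m) × FreshEdges n (claimed h ++ m) m'

HStrategy : Set
HStrategy = History → List Edge → List Edge

data Reachable (n q : ℕ) (σ : HStrategy) : History → Set where
  start : Reachable n q σ []
  step  : ∀ {h m} → Reachable n q σ h → LegalV n q h m →
          Reachable n q σ (h ++ ((m , σ h m) ∷ []))

HWinning : ℕ → ℕ → HStrategy → Set
HWinning n q σ = ∀ h m → Reachable n q σ h → LegalV n q h m →
  ¬ Crossing n (claimedV h ++ m) × LegalH n h m (σ h m)

{-# OPTIONS --safe #-}

-- Contract every dual edge of V and delete every dual edge of H. A dual vertex has four incident edges, and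
-- contracting an edge joins two clusters of degree four into one of degree six, so the two edges H gets for it
-- bring the degree back to four. H moreover keeps a height on the clusters, 0 on the bottom row, n on the top row,
-- changing by at most 1 along unclaimed edges: a merged cluster takes the smaller height, which H can afford
-- because a cluster below height n - 1 has at most one edge going up. At height n - 1 up to three edges may lead to
-- the top row, and the fourth, the horizontal one to the right, stays level; when such a cluster joins the top, it
-- is that level edge which H leaves unclaimed. With at most q < n edges V cannot climb from height 0 to height n
-- in one turn, so bottom and top are never joined.
module Submission where

open import Defs
open import Data.Nat using (ℕ; zero; suc; _+_; _*_; _∸_; _⊓_; _≤_; _<_; z≤n; s≤s)
open import Data.Nat.Properties
open import Data.Integer as ℤ using (ℤ; +_; -[1+_]; 0ℤ; 1ℤ; ∣_∣)
import Data.Integer.Properties as ℤ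
open import Data.Product using (Σ; ∃; _×_; _,_; proj₁; proj₂)
open import Data.Product.Properties using (≡-dec)
open import Data.Sum as Sum using (_⊎_; inj₁; inj₂; [_,_]′)
open import Data.Bool using (Bool; true; false; not)
import Data.Bool.Properties as Bool
open import Data.Maybe using (Maybe; just; nothing)
open import Data.Maybe.Properties using (just-injective)
open import Data.Unit using (⊤; tt)
open import Data.Empty using (⊥)
open import Data.List using (List; []; _∷_; _++_; length; head; last; map; concat; foldl; filter; take; drop)
open import Data.List.Properties using
  (filter-notAll; length-filter; length-++; length-map; map-++; concat-++; ++-assoc; ++-identityʳ; foldl-∷ʳ)
open import Data.List.Membership.Propositional using (_∈_; _∉_)
open import Data.List.Membership.Propositional.Properties
open import Data.List.Relation.Unary.Any as Any using (here; there)
open import Data.List.Relation.Unary.All as All using (All; []; _∷_)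
open import Data.List.Relation.Unary.Linked using (Linked; []; _∷_)
open import Data.List.Relation.Unary.AllPairs using ([]; _∷_)
open import Data.List.Relation.Binary.Permutation.Propositional using (_↭_; ↭-refl; ↭-sym; ↭-trans; prep; swap)
open import Data.List.Relation.Binary.Permutation.Propositional.Properties using (∈-resp-↭; ↭-length; shift; ++⁺ʳ)
open import Function using (_∘_; id)
open import Relation.Nullary using (¬_; Dec; yes; no; contradiction; _×-dec_; ¬?)
import Relation.Nullary.Decidable as Dec
open import Relation.Binary.Definitions using (tri<; tri≈; tri>)
open import Relation.Binary.PropositionalEquality

-- Directed dual edges and lists of them.

HalfEdge : Set
HalfEdge = Edge × Bool

src : HalfEdge → DualVertex
src (e , true)  = proj₁ (dualEnds e)
src (e , false) = proj₂ (dualEnds e)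

opp : HalfEdge → HalfEdge
opp (e , d) = e , not d

tgt : HalfEdge → DualVertex
tgt x = src (opp x)

opp-involutive : ∀ x → opp (opp x) ≡ x
opp-involutive (e , d) = cong (e ,_) (Bool.not-involutive d)

opp-≢ : ∀ x → x ≢ opp x
opp-≢ (e , true)  ()
opp-≢ (e , false) ()

-- The dual of a `ver` edge is horizontal, and `true` directs it towards larger first coordinate. A
-- direction and its reverse are never both `Right`; this asymmetry decides conflicts between level
-- half-edges of two clusters of height `N`.
Right : HalfEdge → Set
Right (hor _ _ , _)     = ⊥
Right (ver _ _ , true)  = ⊤
Right (ver _ _ , false) = ⊥

Right-asym : ∀ x → Right x → ¬ Right (opp x)
Right-asym (ver _ _ , true) _ ()

_≟ᴱ_ : (e f : Edge) → Dec (e ≡ f)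
hor x y ≟ᴱ hor x' y' = Dec.map′ (λ (p , q) → cong₂ hor p q) (λ { refl → refl , refl }) ((x ℤ.≟ x') ×-dec (y ≟ y'))
ver x y ≟ᴱ ver x' y' = Dec.map′ (λ (p , q) → cong₂ ver p q) (λ { refl → refl , refl }) ((x ℤ.≟ x') ×-dec (y ≟ y'))
hor _ _ ≟ᴱ ver _ _   = no λ ()
ver _ _ ≟ᴱ hor _ _   = no λ ()

_≟ᴴ_ : (x y : HalfEdge) → Dec (x ≡ y)
_≟ᴴ_ = ≡-dec _≟ᴱ_ Bool._≟_

_∈ᴱ?_ : (e : Edge) (es : List Edge) → Dec (e ∈ es)
e ∈ᴱ? es = Any.any? (e ≟ᴱ_) es

_∈ᴴ?_ : (x : HalfEdge) (xs : List HalfEdge) → Dec (x ∈ xs)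
x ∈ᴴ? xs = Any.any? (x ≟ᴴ_) xs

valid? : ∀ n e → Dec (ValidEdge n e)
valid? n (hor x y) = (1 ≤? y) ×-dec (y ≤? n)
valid? n (ver x y) = (1 ≤? y) ×-dec (suc y ≤? n)

without : Edge → List HalfEdge → List HalfEdge
without e = filter (λ x → ¬? (proj₁ x ≟ᴱ e))

∈-without⁺ : ∀ {e x xs} → proj₁ x ≢ e → x ∈ xs → x ∈ without e xs
∈-without⁺ x≢e x∈xs = ∈-filter⁺ (λ x → ¬? (proj₁ x ≟ᴱ _)) x∈xs x≢e

∈-without⁻ : ∀ {e x xs} → x ∈ without e xs → x ∈ xs
∈-without⁻ {xs = xs} p = proj₁ (∈-filter⁻ (λ x → ¬? (proj₁ x ≟ᴱ _)) {xs = xs} p)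

length-without : ∀ e xs → length (without e xs) ≤ length xs
length-without e = length-filter (λ x → ¬? (proj₁ x ≟ᴱ e))

length-without-< : ∀ {x xs} → x ∈ xs → length (without (proj₁ x) xs) < length xs
length-without-< {x} {xs} p =
  filter-notAll (λ y → ¬? (proj₁ y ≟ᴱ proj₁ x)) xs (Any.map (λ { refl ¬r → ¬r refl }) p)

-- `without` drops both directions of an edge, and `x` and `opp x` are distinct entries, so two
-- places become free.
length-without-<< : ∀ {x xs} → x ∈ xs → opp x ∈ xs → 2 + length (without (proj₁ x) xs) ≤ length xs
length-without-<< {x} (here p) (here q) = contradiction (trans p (sym q)) (opp-≢ x)
length-without-<< {x} {y ∷ ys} (here p) (there q) with proj₁ y ≟ᴱ proj₁ x
... | yes _ = s≤s (length-without-< q)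
... | no ne = contradiction (cong proj₁ (sym p)) ne
length-without-<< {x} {y ∷ ys} (there p) (here q) with proj₁ y ≟ᴱ proj₁ x
... | yes _ = s≤s (length-without-< p)
... | no ne = contradiction (cong proj₁ (sym q)) ne
length-without-<< {x} {y ∷ ys} (there p) (there q) with proj₁ y ≟ᴱ proj₁ x
... | yes _ = m≤n⇒m≤1+n (length-without-<< p q)
... | no ne = s≤s (length-without-<< p q)

-- Cluster labels, relabelling and length estimates.

Label : Set
Label = DualVertex

_≟ᴸ_ : (a b : Label) → Dec (a ≡ b)
_≟ᴸ_ = ≡-dec ℤ._≟_ ℤ._≟_

relabel : Label → Maybe Label → Maybe Label → Maybe Label
relabel b t nothing  = nothing
relabel b t (just d) with d ≟ᴸ b
... | yes _ = t
... | no  _ = just d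

relabel-≡ : ∀ b t → relabel b t (just b) ≡ t
relabel-≡ b t with b ≟ᴸ b
... | yes _ = refl
... | no ne = contradiction refl ne

relabel-≢ : ∀ {b d} t → d ≢ b → relabel b t (just d) ≡ just d
relabel-≢ {b} {d} t ne with d ≟ᴸ b
... | yes eq = contradiction eq ne
... | no _   = refl

relabel⁻¹ : ∀ {b t d} m → relabel b t m ≡ just d → (m ≡ just d × d ≢ b) ⊎ (m ≡ just b × t ≡ just d)
relabel⁻¹ {b} (just d) eq with d ≟ᴸ b
... | yes refl = inj₂ (refl , eq)
relabel⁻¹ {b} (just d) refl | no ne = inj₁ (refl , ne)

relabel⁻¹-nothing : ∀ {b} m → relabel b nothing m ≡ nothing → m ≡ nothing ⊎ m ≡ just b
relabel⁻¹-nothing nothing _ = inj₁ refl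
relabel⁻¹-nothing {b} (just d) eq with d ≟ᴸ b
... | yes refl = inj₂ refl

head-or-tail : ∀ {A : Set} {x : A} xs → x ∈ xs → x ∈ take 1 xs ⊎ x ∈ drop 1 xs
head-or-tail (_ ∷ _) (here p)  = inj₁ (here p)
head-or-tail (_ ∷ _) (there p) = inj₂ p

∈-take1⁻ : ∀ {A : Set} {x : A} xs → x ∈ take 1 xs → x ∈ xs
∈-take1⁻ (_ ∷ _) (here p) = here p

length-take1 : ∀ {A : Set} (xs : List A) → length (take 1 xs) ≤ 1
length-take1 []      = z≤n
length-take1 (_ ∷ _) = ≤-refl

length-drop1 : ∀ {A : Set} (xs : List A) {k} → length xs ≤ suc k → length (drop 1 xs) ≤ k
length-drop1 []      _       = z≤n
length-drop1 (_ ∷ _) (s≤s p) = p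

length-++-≤ : ∀ {A : Set} (xs ys : List A) {i j} → length xs ≤ i → length ys ≤ j → length (xs ++ ys) ≤ i + j
length-++-≤ xs ys p q = subst (_≤ _) (sym (length-++ xs)) (+-mono-≤ p q)

-- The accounting rule for pending claims: if `i` of them lapse, `i + 2` new ones may be added, for
-- a net growth of the two edges H receives per edge of V.
length-++-budget : ∀ {A : Set} (xs ys : List A) {k} i → i + length xs ≤ k → length ys ≤ i + 2 → length (xs ++ ys) ≤ k + 2
length-++-budget xs ys {k} i p q = begin
  length (xs ++ ys)       ≤⟨ length-++-≤ xs ys ≤-refl q ⟩
  length xs + (i + 2)     ≡⟨ sym (+-assoc (length xs) i 2) ⟩
  length xs + i + 2       ≡⟨ cong (_+ 2) (+-comm (length xs) i) ⟩
  i + length xs + 2       ≤⟨ +-monoˡ-≤ 2 p ⟩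
  k + 2                   ∎
  where open ≤-Reasoning

module _ {A : Set} where

  update : (Label → A) → Label → A → Label → A
  update f a v d with d ≟ᴸ a
  ... | yes _ = v
  ... | no  _ = f d

  update-≡ : ∀ f a v → update f a v a ≡ v
  update-≡ f a v with a ≟ᴸ a
  ... | yes _ = refl
  ... | no ne = contradiction refl ne

  update-≢ : ∀ f {a} v {d} → d ≢ a → update f a v d ≡ f d
  update-≢ f {a} v {d} ne with d ≟ᴸ a
  ... | yes eq = contradiction eq ne
  ... | no _   = refl

-- Once `b` is absorbed, its half-edges start in `a`; leaving them listed under `b` would break
-- `at-ups` and `at-lvl`.
transfer : (Label → List HalfEdge) → (a b : Label) → List HalfEdge → Label → List HalfEdge
transfer f a b xs = update (update f b []) a xs

transfer-at : ∀ f a b {xs x} → x ∈ xs → x ∈ transfer f a b xs a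
transfer-at f a b {xs} p = subst (_ ∈_) (sym (update-≡ _ a xs)) p

transfer⁻¹ : ∀ f a b {xs x} d → x ∈ transfer f a b xs d → (d ≡ a × x ∈ xs) ⊎ (d ≢ a × d ≢ b × x ∈ f d)
transfer⁻¹ f a b d p with d ≟ᴸ a
... | yes eq = inj₁ (eq , p)
... | no ne with d ≟ᴸ b
...   | no ne' = inj₂ (ne , ne' , p)

-- Clusters with heights and the invariant.

-- Clusters are named by labels; the cluster of the top row is nothing. The free half-edges of a cluster
-- are split into ups, which may lead to a higher cluster, and lvl, which may not. Both lists may contain
-- half-edges that are no longer free: only upper bounds on their lengths matter.
record State : Set where
  field
    comp    : DualVertex → Maybe Label
    ht      : Label → ℕ
    ups lvl : Label → List HalfEdge

open State

module Strategy (N : ℕ) where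

  n : ℕ
  n = suc N

  Open : List Edge → HalfEdge → Set
  Open X x = ValidEdge n (proj₁ x) × proj₁ x ∉ X

  -- During H's reply, K₁ and K₂ hold the half-edges he has decided to claim, those of the top cluster and
  -- those of the other clusters; V's pending edges may still use them. The last clause keeps the level edge
  -- of a cluster of height N from being the one edge leading up from a lower cluster.
  Upward : List HalfEdge → State → Label → HalfEdge → Set
  Upward K₁ s a x =
    ht s a ≡ N
    ⊎ (comp s (tgt x) ≡ nothing × opp x ∈ K₁)
    ⊎ (Σ Label λ b → comp s (tgt x) ≡ just b × ht s b ≤ suc (ht s a) × (ht s b ≡ N → ¬ Right (opp x)))

  -- Two rules are special to height `N`. A level half-edge points right, so no edge is level in
  -- both directions between two such clusters. And unless H is about to claim the edge, its other
  -- end also has height `N`, so the edge may stay unclaimed when the cluster joins the top.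
  Level : List HalfEdge → List HalfEdge → State → Label → HalfEdge → Set
  Level K₁ K₂ s a x =
    (ht s a ≡ N → Right x)
    × ((comp s (tgt x) ≡ nothing × opp x ∈ K₁)
       ⊎ (Σ Label λ b → comp s (tgt x) ≡ just b × ht s b ≤ ht s a × (ht s a ≡ N → ht s b ≡ N ⊎ opp x ∈ K₂)))

  Size : State → Label → Set
  Size s a = (ht s a ≡ N × length (ups s a) ≤ 3 × length (lvl s a) ≤ 1)
           ⊎ (ht s a < N × length (ups s a) ≤ 1 × length (lvl s a) ≤ 3)

  -- `X` holds the edges claimed by either player, `V` those of the vertical player; between turns
  -- `K₁` and `K₂` are empty. `at-ups` and `at-lvl` speak only of sources that still carry a label,
  -- since a cluster swallowed by the top keeps its lists.
  record Inv (X V : List Edge) (K₁ K₂ : List HalfEdge) (s : State) : Set where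
    field
      glue   : ∀ {e} → e ∈ V → comp s (src (e , true)) ≡ comp s (tgt (e , true))
      bottom : ∀ x → Σ Label λ b → comp s (x , 0ℤ) ≡ just b × ht s b ≡ 0
      top    : ∀ x → comp s (x , + n) ≡ nothing
      ht≤N   : ∀ a → ht s a ≤ N
      size   : ∀ a → Size s a
      at-ups : ∀ {x a d} → x ∈ ups s a → comp s (src x) ≡ just d → d ≡ a
      at-lvl : ∀ {x a d} → x ∈ lvl s a → comp s (src x) ≡ just d → d ≡ a
      cover  : ∀ {x a} → Open X x → comp s (src x) ≡ just a → comp s (tgt x) ≢ just a →
               x ∈ K₂ ⊎ x ∈ ups s a ⊎ x ∈ lvl s a
      upward : ∀ {x a} → Open X x → comp s (src x) ≡ just a → comp s (tgt x) ≢ just a →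
               x ∈ ups s a → Upward K₁ s a x
      level  : ∀ {x a} → Open X x → comp s (src x) ≡ just a → comp s (tgt x) ≢ just a →
               x ∈ lvl s a → Level K₁ K₂ s a x

  open Inv

  open-opp : ∀ {X x} → Open X x → Open X (opp x)
  open-opp o = o

  open-tail : ∀ {e X x} → Open (e ∷ X) x → Open X x × proj₁ x ≢ e
  open-tail (v , ∉X) = (v , ∉X ∘ there) , λ { refl → ∉X (here refl) }

  tgt-opp : ∀ s x → comp s (tgt (opp x)) ≡ comp s (src x)
  tgt-opp s x = cong (comp s ∘ src) (opp-involutive x)

  just-≢ : ∀ {m : Maybe Label} {a b} → m ≡ just a → a ≢ b → m ≢ just b
  just-≢ p ne q = ne (just-injective (trans (sym p) q))

  nothing-≢ : ∀ {m : Maybe Label} {b} → m ≡ nothing → m ≢ just b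
  nothing-≢ p q with trans (sym p) q
  ... | ()

  -- Merging two clusters below the top.

  mergeState : State → Label → Label → List HalfEdge → List HalfEdge → State
  mergeState s a b P Q = record
    { comp = λ v → relabel b (just a) (comp s v)
    ; ht   = ht s
    ; ups  = transfer (ups s) a b P
    ; lvl  = transfer (lvl s) a b Q
    }

  -- Common core of all merges of `b` into a cluster `a` that is not higher. Lowering `b` lowers
  -- targets only, which respects the height bounds of half-edges pointing at it; the conditions on
  -- `P` and `Q` account for half-edges whose source drops. What may fail is that level half-edges
  -- at height `N` face height `N`, and the condition bound below as `left` repairs this by claiming
  -- the upward half-edges of `b`.
  merge : ∀ {X V K₁ K₂ s e x a b P Q K} → Inv X V K₁ K₂ s →
    proj₁ x ≡ e → comp s (src x) ≡ just a → comp s (tgt x) ≡ just b → a ≢ b → ht s a ≤ ht s b →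
    (∀ {y} → proj₁ y ≢ e → y ∈ K₂ → y ∈ K) →
    (∀ {y} → proj₁ y ≢ e → y ∈ ups s a ⊎ y ∈ lvl s a → y ∈ K ⊎ y ∈ P ⊎ y ∈ Q) →
    (∀ {y} → proj₁ y ≢ e → y ∈ ups s b ⊎ y ∈ lvl s b → y ∈ K ⊎ y ∈ P ⊎ y ∈ Q) →
    (∀ {y} → proj₁ y ≢ e → ht s b ≡ N → ht s a ≢ N → y ∈ ups s b → y ∈ K) →
    (∀ {y} → y ∈ P → y ∈ ups s a ⊎ (y ∈ lvl s b × ht s b ≤ suc (ht s a))) →
    (∀ {y} → y ∈ Q → y ∈ lvl s a ⊎ (y ∈ lvl s b × ht s b ≡ ht s a)) →
    length P ≤ length (ups s a) → length Q ≤ length (lvl s a) →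
    Inv (e ∷ X) (e ∷ V) K₁ K (mergeState s a b P Q)
  merge {X} {V} {K₁} {K₂} {s} {e} {x} {a} {b} {P} {Q} {K} I refl cx cx' a≢b a≤b keepK keepA keepB left fromP fromQ |P| |Q| =
    record
      { glue = λ { (here refl) → glue-x x cx cx' ; (there p) → cong (relabel b (just a)) (glue I p) }
      ; bottom = bottom' ; top = λ z → cong (relabel b (just a)) (top I z)
      ; ht≤N = ht≤N I ; size = size' ; at-ups = at-ups' ; at-lvl = at-lvl'
      ; cover = cover' ; upward = upward' ; level = level' }
    where
    s' = mergeState s a b P Q
    to-a : ∀ {v} → comp s v ≡ just b → comp s' v ≡ just a
    to-a p = trans (cong (relabel b (just a)) p) (relabel-≡ b (just a))
    stay : ∀ {v d} → comp s v ≡ just d → d ≢ b → comp s' v ≡ just d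
    stay p ne = trans (cong (relabel b (just a)) p) (relabel-≢ (just a) ne)
    from-≢a : ∀ {v} → comp s' v ≢ just a → comp s v ≢ just a × comp s v ≢ just b
    from-≢a ne = (λ p → ne (stay p a≢b)) , (λ p → ne (to-a p))
    glue-x : ∀ x → comp s (src x) ≡ just a → comp s (tgt x) ≡ just b →
      comp s' (src (proj₁ x , true)) ≡ comp s' (tgt (proj₁ x , true))
    glue-x (e , true) p q = trans (stay p a≢b) (sym (to-a q))
    glue-x (e , false) p q = trans (to-a q) (sym (stay p a≢b))
    bottom' : ∀ z → Σ Label λ d → comp s' (z , 0ℤ) ≡ just d × ht s d ≡ 0
    bottom' z with bottom I z
    ... | d , p , h with d ≟ᴸ b
    ...   | yes refl = a , to-a p , n≤0⇒n≡0 (subst (ht s a ≤_) h a≤b)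
    ...   | no ne = d , stay p ne , h
    size' : ∀ d → Size s' d
    size' d with d ≟ᴸ a
    ... | yes refl = Sum.map (λ (p , q , r) → p , ≤-trans |P| q , ≤-trans |Q| r)
                             (λ (p , q , r) → p , ≤-trans |P| q , ≤-trans |Q| r) (size I d)
    ... | no ne with d ≟ᴸ b
    ...   | yes refl = Sum.map (λ (p , _) → p , z≤n , z≤n) (λ (p , _) → p , z≤n , z≤n) (size I d)
    ...   | no ne' = size I d
    at-a : ∀ {v d} → (∀ {d} → comp s v ≡ just d → d ≡ a ⊎ d ≡ b) → comp s' v ≡ just d → d ≡ a
    at-a {v} f p with relabel⁻¹ (comp s v) p
    ... | inj₂ (_ , refl) = refl
    ... | inj₁ (q , ne) = [ id , (λ eq → contradiction eq ne) ]′ (f q)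
    at-off : ∀ {v d g} → (∀ {d} → comp s v ≡ just d → d ≡ g) → g ≢ b → comp s' v ≡ just d → d ≡ g
    at-off {v} f ne p with relabel⁻¹ (comp s v) p
    ... | inj₂ (q , _) = contradiction (sym (f q)) ne
    ... | inj₁ (q , _) = f q
    at-ups' : ∀ {y g d} → y ∈ ups s' g → comp s' (src y) ≡ just d → d ≡ g
    at-ups' {y} {g} y∈ p with transfer⁻¹ (ups s) a b g y∈
    ... | inj₂ (_ , ne , y∈g) = at-off (at-ups I y∈g) ne p
    ... | inj₁ (refl , y∈P) = at-a (λ q → Sum.map (λ r → at-ups I r q) (λ r → at-lvl I (proj₁ r) q) (fromP y∈P)) p
    at-lvl' : ∀ {y g d} → y ∈ lvl s' g → comp s' (src y) ≡ just d → d ≡ g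
    at-lvl' {y} {g} y∈ p with transfer⁻¹ (lvl s) a b g y∈
    ... | inj₂ (_ , ne , y∈g) = at-off (at-lvl I y∈g) ne p
    ... | inj₁ (refl , y∈Q) = at-a (λ q → Sum.map (λ r → at-lvl I r q) (λ r → at-lvl I (proj₁ r) q) (fromQ y∈Q)) p
    cover' : ∀ {y d} → Open (proj₁ x ∷ X) y → comp s' (src y) ≡ just d → comp s' (tgt y) ≢ just d →
             y ∈ K ⊎ y ∈ ups s' d ⊎ y ∈ lvl s' d
    cover' {y} {d} o p q with open-tail {x = y} o | relabel⁻¹ (comp s (src y)) p
    ... | o' , y≢e | inj₂ (p' , refl) with cover I o' p' (proj₂ (from-≢a q))
    ...   | inj₁ r = inj₁ (keepK y≢e r)
    ...   | inj₂ r = Sum.map id (Sum.map (transfer-at (ups s) a b) (transfer-at (lvl s) a b)) (keepB y≢e r)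
    cover' {y} {d} o p q | o' , y≢e | inj₁ (p' , d≢b) with cover I o' p' (λ r → q (stay r d≢b))
    ...   | inj₁ r = inj₁ (keepK y≢e r)
    ...   | inj₂ r with d ≟ᴸ a
    ...     | yes refl = keepA y≢e r
    ...     | no d≢a = inj₂ (Sum.map (subst (y ∈_) (sym (update-≢ (ups s) [] d≢b))) (subst (y ∈_) (sym (update-≢ (lvl s) [] d≢b))) r)
    upward' : ∀ {y d} → Open (proj₁ x ∷ X) y → comp s' (src y) ≡ just d → comp s' (tgt y) ≢ just d →
              y ∈ ups s' d → Upward K₁ s' d y
    upward' {y} {d} o p q y∈ with open-tail {x = y} o | transfer⁻¹ (ups s) a b d y∈ | relabel⁻¹ (comp s (src y)) p
    ... | o' , y≢e | inj₂ (d≢a , d≢b , y∈d) | inj₂ (_ , refl) = contradiction refl d≢a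
    ... | o' , y≢e | inj₂ (d≢a , d≢b , y∈d) | inj₁ (p' , _) with upward I o' p' (λ r → q (stay r d≢b)) y∈d
    ...   | inj₁ h = inj₁ h
    ...   | inj₂ (inj₁ (r , k)) = inj₂ (inj₁ (cong (relabel b (just a)) r , k))
    ...   | inj₂ (inj₂ (g , r , h , t)) with g ≟ᴸ b
    ...     | no g≢b = inj₂ (inj₂ (g , stay r g≢b , h , t))
    ...     | yes refl = inj₂ (inj₂ (a , to-a r , ≤-trans a≤b h , λ a≡N → t (≤-antisym (ht≤N I b) (subst (_≤ ht s b) a≡N a≤b))))
    upward' {y} {d} o p q y∈ | o' , y≢e | inj₁ (refl , y∈P) | z with fromP y∈P
    ... | inj₁ y∈a with z
    ...   | inj₂ (p' , _) = contradiction (sym (at-ups I y∈a p')) a≢b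
    ...   | inj₁ (p' , _) with upward I o' p' (proj₁ (from-≢a q)) y∈a
    ...     | inj₁ h = inj₁ h
    ...     | inj₂ (inj₁ (r , k)) = inj₂ (inj₁ (cong (relabel b (just a)) r , k))
    ...     | inj₂ (inj₂ (g , r , h , t)) = inj₂ (inj₂ (g , stay r (λ { refl → proj₂ (from-≢a q) r }) , h , t))
    upward' {y} {d} o p q y∈ | o' , y≢e | inj₁ (refl , y∈P) | z | inj₂ (y∈b , b≤1+a) with z
    ...   | inj₁ (p' , _) = contradiction (at-lvl I y∈b p') a≢b
    ...   | inj₂ (p' , _) with level I o' p' (proj₂ (from-≢a q)) y∈b | ht s a ≟ N
    ...     | rt , _ | yes h = inj₁ h
    ...     | rt , inj₁ (r , k) | no _ = inj₂ (inj₁ (cong (relabel b (just a)) r , k))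
    -- A level half-edge of `b` becomes an upward one of `a`. If its target has height `N`, so does
    -- `b`; then `y` points right and its reverse does not.
    ...     | rt , inj₂ (g , r , h , t) | no _ =
      inj₂ (inj₂ (g , stay r (λ { refl → proj₂ (from-≢a q) r }) , ≤-trans h b≤1+a ,
        λ g≡N → Right-asym y (rt (≤-antisym (ht≤N I b) (subst (_≤ ht s b) g≡N h)))))
    level' : ∀ {y d} → Open (proj₁ x ∷ X) y → comp s' (src y) ≡ just d → comp s' (tgt y) ≢ just d →
              y ∈ lvl s' d → Level K₁ K s' d y
    level' {y} {d} o p q y∈ with open-tail {x = y} o | transfer⁻¹ (lvl s) a b d y∈ | relabel⁻¹ (comp s (src y)) p
    ... | o' , y≢e | inj₂ (d≢a , d≢b , y∈d) | inj₂ (_ , refl) = contradiction refl d≢a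
    ... | o' , y≢e | inj₂ (d≢a , d≢b , y∈d) | inj₁ (p' , _) with level I o' p' (λ r → q (stay r d≢b)) y∈d
    ...   | rt , inj₁ (r , k) = rt , inj₁ (cong (relabel b (just a)) r , k)
    ...   | rt , inj₂ (g , r , h , t) with g ≟ᴸ b
    ...     | no g≢b = rt , inj₂ (g , stay r g≢b , h , Sum.map id (keepK y≢e) ∘ t)
    ...     | yes refl = rt , inj₂ (a , to-a r , ≤-trans a≤b h , λ d≡N → facing d≡N (t d≡N))
      where
      -- When `b` drops from height `N`, a level `y` aimed at it points right. Its reverse leaves
      -- `b`, cannot be level there, and so is pending already or becomes so through `left`.
      facing : ht s d ≡ N → ht s b ≡ N ⊎ opp y ∈ K₂ → ht s a ≡ N ⊎ opp y ∈ K
      facing d≡N (inj₂ k) = inj₂ (keepK y≢e k)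
      facing d≡N (inj₁ b≡N) with ht s a ≟ N
      ... | yes a≡N = inj₁ a≡N
      ... | no a≢N with tgt≢b
        where
        tgt≢b : comp s (tgt (opp y)) ≢ just b
        tgt≢b w = d≢b (just-injective (trans (sym p') (trans (sym (tgt-opp s y)) w)))
      ...   | w with cover I (open-opp {x = y} o') r w
      ...     | inj₁ k = inj₂ (keepK y≢e k)
      ...     | inj₂ (inj₁ u) = inj₂ (left y≢e b≡N a≢N u)
      ...     | inj₂ (inj₂ u) = contradiction (proj₁ (level I (open-opp {x = y} o') r w u) b≡N) (Right-asym y (rt d≡N))
    level' {y} {d} o p q y∈ | o' , y≢e | inj₁ (refl , y∈Q) | z with fromQ y∈Q
    ... | inj₁ y∈a with z
    ...   | inj₂ (p' , _) = contradiction (sym (at-lvl I y∈a p')) a≢b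
    ...   | inj₁ (p' , _) with level I o' p' (proj₁ (from-≢a q)) y∈a
    ...     | rt , inj₁ (r , k) = rt , inj₁ (cong (relabel b (just a)) r , k)
    ...     | rt , inj₂ (g , r , h , t) = rt , inj₂ (g , stay r (λ { refl → proj₂ (from-≢a q) r }) , h , Sum.map id (keepK y≢e) ∘ t)
    level' {y} {d} o p q y∈ | o' , y≢e | inj₁ (refl , y∈Q) | z | inj₂ (y∈b , b≡a) with z
    ...   | inj₁ (p' , _) = contradiction (at-lvl I y∈b p') a≢b
    ...   | inj₂ (p' , _) with level I o' p' (proj₂ (from-≢a q)) y∈b
    ...     | rt , inj₁ (r , k) = rt ∘ trans b≡a , inj₁ (cong (relabel b (just a)) r , k)
    ...     | rt , inj₂ (g , r , h , t) = rt ∘ trans b≡a ,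
      inj₂ (g , stay r (λ { refl → proj₂ (from-≢a q) r }) , subst (ht s g ≤_) b≡a h , Sum.map id (keepK y≢e) ∘ t ∘ trans b≡a)

  -- Merges leave the top cluster alone, so an edge that does not link the top to another cluster
  -- keeps this property while others are merged.
  SameTop : State → State → Set
  SameTop s s' = ∀ v → (comp s v ≡ nothing → comp s' v ≡ nothing)
                     × (∀ {a} → comp s v ≡ just a → ∃ λ a' → comp s' v ≡ just a')

  Merged : List Edge → List Edge → List HalfEdge → List HalfEdge → State → Edge → Set
  Merged X V K₁ K₂ s e = Σ (List HalfEdge) λ K → Σ State λ s' →
    Inv (e ∷ X) (e ∷ V) K₁ K s' × length K ≤ length K₂ + 2 × SameTop s s'

  mergeState-SameTop : ∀ s a b P Q → SameTop s (mergeState s a b P Q)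
  mergeState-SameTop s a b P Q v with comp s v
  ... | nothing = (λ _ → refl) , λ ()
  ... | just d with d ≟ᴸ b
  ...   | yes _ = (λ ()) , λ _ → a , refl
  ...   | no _  = (λ ()) , λ _ → d , refl

  module Merging {X V K₁ K₂ s} (I : Inv X V K₁ K₂ s) {x : HalfEdge} {a b : Label} (o : Open X x)
    (src≡a : comp s (src x) ≡ just a) (tgt≡b : comp s (tgt x) ≡ just b) (a≢b : a ≢ b) (a≤b : ht s a ≤ ht s b) where

    e : Edge
    e = proj₁ x

    opp-covered : opp x ∈ K₂ ⊎ opp x ∈ ups s b ⊎ opp x ∈ lvl s b
    opp-covered = cover I (open-opp {x = x} o) tgt≡b (just-≢ (trans (tgt-opp s x) src≡a) a≢b)

    K R U : List HalfEdge
    K = without e K₂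
    R = without e (lvl s b)
    U = without e (ups s b)

    free-≤4 : length (lvl s b) + length (ups s b) ≤ 4
    free-≤4 = [ (λ (_ , p , q) → +-mono-≤ q p) , (λ (_ , p , q) → +-mono-≤ q p) ]′ (size I b)

    K≤ : length K ≤ length K₂
    K≤ = length-without e K₂

    R≤ : length R ≤ length (lvl s b)
    R≤ = length-without e (lvl s b)

    U≤ : length U ≤ length (ups s b)
    U≤ = length-without e (ups s b)

    -- V takes an edge that H had planned to claim, so a place in `K₂` becomes free and `a` keeps
    -- its lists. All of `b` is claimed: at most four half-edges if `opp x` was pending too and
    -- freed a second place, at most three otherwise.
    absorb : x ∈ K₂ → Merged X V K₁ K₂ s e
    absorb x∈K = K ++ R ++ U , _ ,
      merge {x = x} I refl src≡a tgt≡b a≢b a≤b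
        (λ ne p → ∈-++⁺ˡ (∈-without⁺ ne p))
        (λ _ p → inj₂ p)
        (λ { ne (inj₁ p) → inj₁ (∈-++⁺ʳ K (∈-++⁺ʳ R (∈-without⁺ ne p)))
           ; ne (inj₂ p) → inj₁ (∈-++⁺ʳ K (∈-++⁺ˡ (∈-without⁺ ne p))) })
        (λ ne _ _ p → ∈-++⁺ʳ K (∈-++⁺ʳ R (∈-without⁺ ne p)))
        inj₁ inj₁ ≤-refl ≤-refl ,
      bound opp-covered ,
      mergeState-SameTop s a b (ups s a) (lvl s a)
      where
      bound : opp x ∈ K₂ ⊎ opp x ∈ ups s b ⊎ opp x ∈ lvl s b → length (K ++ R ++ U) ≤ length K₂ + 2
      bound (inj₁ p) = length-++-budget K (R ++ U) 2 (length-without-<< x∈K p)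
        (≤-trans (length-++-≤ R U R≤ U≤) free-≤4)
      bound (inj₂ (inj₁ p)) = length-++-budget K (R ++ U) 1 (length-without-< x∈K)
        (≤-pred (≤-trans (≤-reflexive (cong suc (length-++ R)))
          (≤-trans (≤-reflexive (sym (+-suc (length R) (length U))))
            (≤-trans (+-mono-≤ R≤ (length-without-< p)) free-≤4))))
      bound (inj₂ (inj₂ p)) = length-++-budget K (R ++ U) 1 (length-without-< x∈K)
        (≤-pred (≤-trans (≤-reflexive (cong suc (length-++ R)))
            (≤-trans (+-mono-≤ (length-without-< p) U≤) free-≤4)))

    -- Of the at most four half-edges of `b`, `opp x` disappears and a level one is kept, so two are
    -- left to claim; if `opp x` was pending, its place pays for a third. The hypothesis excludes a
    -- `b` of height `N` losing its only level half-edge to `e`, which would leave three upward ones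
    -- to claim.
    exchange-bound : (ht s b ≡ N → opp x ∉ lvl s b) → length (K ++ drop 1 R ++ U) ≤ length K₂ + 2
    exchange-bound right with size I b | opp-covered
    ... | inj₁ (_ , p , q) | inj₁ r = length-++-budget K (drop 1 R ++ U) 1 (length-without-< r)
      (length-++-≤ (drop 1 R) U (length-drop1 R (≤-trans R≤ q)) (≤-trans U≤ p))
    ... | inj₂ (_ , p , q) | inj₁ r = length-++-budget K (drop 1 R ++ U) 1 (length-without-< r)
      (length-++-≤ (drop 1 R) U (length-drop1 R (≤-trans R≤ q)) (≤-trans U≤ p))
    ... | inj₁ (_ , p , q) | inj₂ (inj₁ r) = length-++-budget K (drop 1 R ++ U) 0 K≤
      (length-++-≤ (drop 1 R) U (length-drop1 R (≤-trans R≤ q)) (≤-pred (≤-trans (length-without-< r) p)))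
    ... | inj₂ (_ , p , q) | inj₂ (inj₁ r) = length-++-budget K (drop 1 R ++ U) 0 K≤
      (length-++-≤ (drop 1 R) U (length-drop1 R (≤-trans R≤ q)) (≤-pred (≤-trans (length-without-< r) p)))
    ... | inj₁ (b≡N , _) | inj₂ (inj₂ r) = contradiction r (right b≡N)
    ... | inj₂ (_ , p , q) | inj₂ (inj₂ r) = length-++-budget K (drop 1 R ++ U) 0 K≤
      (length-++-≤ (drop 1 R) U (length-drop1 R (≤-pred (≤-trans (length-without-< r) q))) (≤-trans U≤ p))

    replaced-length : ∀ {xs} → x ∈ xs → length (without e xs ++ take 1 R) ≤ length xs
    replaced-length {xs} p = begin
      length (without e xs ++ take 1 R)  ≤⟨ length-++-≤ (without e xs) _ ≤-refl (length-take1 R) ⟩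
      length (without e xs) + 1          ≡⟨ +-comm _ 1 ⟩
      suc (length (without e xs))        ≤⟨ length-without-< p ⟩
      length xs                          ∎
      where open ≤-Reasoning

    -- A level half-edge of b takes the place of x among the free half-edges of a.
    exchange-ups : x ∈ ups s a → (ht s b ≡ N → opp x ∉ lvl s b) → ht s b ≤ suc (ht s a) → Merged X V K₁ K₂ s e
    exchange-ups x∈a right b≤1+a = K ++ drop 1 R ++ U , _ ,
      merge {x = x} {P = without e (ups s a) ++ take 1 R} {Q = lvl s a} I refl src≡a tgt≡b a≢b a≤b
        (λ ne p → ∈-++⁺ˡ (∈-without⁺ ne p))
        (λ { ne (inj₁ p) → inj₂ (inj₁ (∈-++⁺ˡ (∈-without⁺ ne p))) ; _ (inj₂ p) → inj₂ (inj₂ p) })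
        (λ { ne (inj₁ p) → inj₁ (∈-++⁺ʳ K (∈-++⁺ʳ (drop 1 R) (∈-without⁺ ne p)))
           ; ne (inj₂ p) → [ (λ r → inj₂ (inj₁ (∈-++⁺ʳ (without e (ups s a)) r))) , (λ r → inj₁ (∈-++⁺ʳ K (∈-++⁺ˡ r))) ]′
               (head-or-tail R (∈-without⁺ ne p)) })
        (λ ne _ _ p → ∈-++⁺ʳ K (∈-++⁺ʳ (drop 1 R) (∈-without⁺ ne p)))
        (λ p → Sum.map ∈-without⁻ (λ r → ∈-without⁻ (∈-take1⁻ R r) , b≤1+a) (∈-++⁻ (without e (ups s a)) p))
        inj₁ (replaced-length x∈a) ≤-refl ,
      exchange-bound right ,
      mergeState-SameTop s a b (without e (ups s a) ++ take 1 R) (lvl s a)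

    -- With equal heights the inherited half-edge stays level, as its source does not drop.
    exchange-lvl : x ∈ lvl s a → (ht s b ≡ N → opp x ∉ lvl s b) → ht s b ≡ ht s a → Merged X V K₁ K₂ s e
    exchange-lvl x∈a right b≡a = K ++ drop 1 R ++ U , _ ,
      merge {x = x} {P = ups s a} {Q = without e (lvl s a) ++ take 1 R} I refl src≡a tgt≡b a≢b a≤b
        (λ ne p → ∈-++⁺ˡ (∈-without⁺ ne p))
        (λ { ne (inj₂ p) → inj₂ (inj₂ (∈-++⁺ˡ (∈-without⁺ ne p))) ; _ (inj₁ p) → inj₂ (inj₁ p) })
        (λ { ne (inj₁ p) → inj₁ (∈-++⁺ʳ K (∈-++⁺ʳ (drop 1 R) (∈-without⁺ ne p)))
           ; ne (inj₂ p) → [ (λ r → inj₂ (inj₂ (∈-++⁺ʳ (without e (lvl s a)) r))) , (λ r → inj₁ (∈-++⁺ʳ K (∈-++⁺ˡ r))) ]′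
               (head-or-tail R (∈-without⁺ ne p)) })
        (λ ne _ _ p → ∈-++⁺ʳ K (∈-++⁺ʳ (drop 1 R) (∈-without⁺ ne p)))
        inj₁
        (λ p → Sum.map ∈-without⁻ (λ r → ∈-without⁻ (∈-take1⁻ R r) , b≡a) (∈-++⁻ (without e (lvl s a)) p))
        ≤-refl (replaced-length x∈a) ,
      exchange-bound right ,
      mergeState-SameTop s a b (ups s a) (without e (lvl s a) ++ take 1 R)

  -- As `b` is higher, `x` is not level at `a`. If it is upward and `b` has height `N`, the last
  -- clause of `Upward` says that `opp x` does not point right, so it is not the level half-edge of
  -- `b`.
  merge-up : ∀ {X V K₁ K₂ s x a b} → Inv X V K₁ K₂ s → Open X x →
    comp s (src x) ≡ just a → comp s (tgt x) ≡ just b → ht s a < ht s b → Merged X V K₁ K₂ s (proj₁ x)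
  merge-up {X} {V} {K₁} {K₂} {s} {x} {a} {b} I o p q a<b = go (cover I o p (just-≢ q (a≢b ∘ sym)))
    where
    a≢b : a ≢ b
    a≢b refl = <-irrefl refl a<b
    open Merging I {x} o p q a≢b (<⇒≤ a<b)
    go : x ∈ K₂ ⊎ x ∈ ups s a ⊎ x ∈ lvl s a → Merged X V K₁ K₂ s (proj₁ x)
    go (inj₁ r) = absorb r
    go (inj₂ (inj₁ r)) with upward I o p (just-≢ q (a≢b ∘ sym)) r
    ... | inj₁ a≡N = contradiction (ht≤N I b) (<⇒≱ (subst (_< ht s b) a≡N a<b))
    ... | inj₂ (inj₁ (t , _)) = contradiction q (nothing-≢ t)
    ... | inj₂ (inj₂ (g , t , h , ne)) with just-injective (trans (sym t) q)
    ...   | refl = exchange-ups r (λ b≡N u → ne b≡N (proj₁ (level I (open-opp {x = x} o) q (just-≢ (trans (tgt-opp s x) p) a≢b) u) b≡N)) h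
    go (inj₂ (inj₂ r)) with level I o p (just-≢ q (a≢b ∘ sym)) r
    ... | _ , inj₁ (t , _) = contradiction q (nothing-≢ t)
    ... | _ , inj₂ (g , t , h , _) with just-injective (trans (sym t) q)
    ...   | refl = contradiction h (<⇒≱ a<b)

  -- Either cluster may absorb the other. At height `N` the two directions of an edge cannot both be
  -- level, since both would point right; hence one choice always meets the hypothesis of
  -- `exchange-bound`.
  merge-flat : ∀ {X V K₁ K₂ s x a b} → Inv X V K₁ K₂ s → Open X x →
    comp s (src x) ≡ just a → comp s (tgt x) ≡ just b → a ≢ b → ht s a ≡ ht s b → Merged X V K₁ K₂ s (proj₁ x)
  merge-flat {X} {V} {K₁} {K₂} {s} {x} {a} {b} I o p q a≢b a≡b = go (cover I o p (just-≢ q (a≢b ∘ sym))) (cover I o' q p'≢)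
    where
    o' = open-opp {x = x} o
    p' = trans (tgt-opp s x) p
    p'≢ = just-≢ p' a≢b
    module F = Merging I {x} o p q a≢b (≤-reflexive a≡b)
    module B = Merging I {opp x} o' q p' (a≢b ∘ sym) (≤-reflexive (sym a≡b))
    right : ht s b ≡ N → x ∈ lvl s a → opp x ∉ lvl s b
    right b≡N r r' = Right-asym x (proj₁ (level I o p (just-≢ q (a≢b ∘ sym)) r) (trans a≡b b≡N))
                                  (proj₁ (level I o' q p'≢ r') b≡N)
    go : x ∈ K₂ ⊎ x ∈ ups s a ⊎ x ∈ lvl s a → opp x ∈ K₂ ⊎ opp x ∈ ups s b ⊎ opp x ∈ lvl s b →
      Merged X V K₁ K₂ s (proj₁ x)
    go (inj₁ r) _ = F.absorb r
    go _ (inj₁ r) = B.absorb r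
    go (inj₂ (inj₂ r)) _ = F.exchange-lvl r (λ b≡N → right b≡N r) (sym a≡b)
    -- The lists `ups` and `lvl` of a cluster may overlap, so membership in `lvl` has to be tested
    -- separately.
    go (inj₂ (inj₁ r)) (inj₂ (inj₁ r')) with opp x ∈ᴴ? lvl s b
    ... | no ∉b = F.exchange-ups r (λ _ → ∉b) (≤-trans (≤-reflexive (sym a≡b)) (n≤1+n _))
    ... | yes r'' with x ∈ᴴ? lvl s a
    ...   | no ∉a = B.exchange-lvl r'' (λ _ → ∉a ∘ subst (_∈ lvl s a) (opp-involutive x)) a≡b
    ...   | yes u = F.exchange-lvl u (λ b≡N → right b≡N u) (sym a≡b)
    go (inj₂ (inj₁ r)) (inj₂ (inj₂ r'')) with x ∈ᴴ? lvl s a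
    ... | no ∉a = B.exchange-lvl r'' (λ _ → ∉a ∘ subst (_∈ lvl s a) (opp-involutive x)) a≡b
    ... | yes u = F.exchange-lvl u (λ b≡N → right b≡N u) (sym a≡b)

  -- Joining a cluster to the top.

  -- The top cluster grows downwards by at most one row per edge; p counts the edges used.
  Reach : List Edge → State → ℕ → Set
  Reach X s p = ∀ y {d} → Open X y → comp s (src y) ≡ nothing → comp s (tgt y) ≡ just d → N ≤ ht s d + p

  joinState : State → Label → State
  joinState s b = record s { comp = λ v → relabel b nothing (comp s v) }

  module Joining {X V K₁ s} (I : Inv X V K₁ [] s) {x : HalfEdge} {b : Label} {p : ℕ} (o : Open X x) (reach : Reach X s p)
    (src≡top : comp s (src x) ≡ nothing) (tgt≡b : comp s (tgt x) ≡ just b) (p<N : p < N) where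

    e : Edge
    e = proj₁ x

    s' : State
    s' = joinState s b

    K R U : List HalfEdge
    K = without e K₁
    R = without e (lvl s b)
    U = without e (ups s b)

    to-top : ∀ {v} → comp s v ≡ just b → comp s' v ≡ nothing
    to-top q = trans (cong (relabel b nothing) q) (relabel-≡ b nothing)

    stay : ∀ {v d} → comp s v ≡ just d → d ≢ b → comp s' v ≡ just d
    stay q ne = trans (cong (relabel b nothing) q) (relabel-≢ nothing ne)

    unchanged : ∀ {v d} → comp s' v ≡ just d → comp s v ≡ just d × d ≢ b
    unchanged {v} q with relabel⁻¹ (comp s v) q
    ... | inj₁ r = r

    free : ∀ {y a} → Open X y → comp s (src y) ≡ just a → comp s (tgt y) ≢ just a → y ∈ ups s a ⊎ y ∈ lvl s a
    free o q r with cover I o q r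
    ... | inj₂ t = t

    -- All half-edges of `b` are claimed, except that level ones may be spared at height `N`. As no
    -- `K₂` is pending, these lead to height `N`, and clusters of that height are allowed to touch
    -- the top.
    join : ∀ {K'} →
      (∀ {y} → proj₁ y ≢ e → y ∈ K₁ → y ∈ K') →
      (∀ {y} → proj₁ y ≢ e → y ∈ ups s b → y ∈ K') →
      (∀ {y} → proj₁ y ≢ e → y ∈ lvl s b → y ∈ K' ⊎ ht s b ≡ N) →
      Inv (e ∷ X) (e ∷ V) K' [] s'
    join {K'} keepK claimU claimR = record
      { glue = λ { (here refl) → glue-x x src≡top tgt≡b ; (there q) → cong (relabel b nothing) (glue I q) }
      ; bottom = bottom' ; top = λ z → cong (relabel b nothing) (top I z)
      ; ht≤N = ht≤N I ; size = size I
      ; at-ups = λ q r → at-ups I q (proj₁ (unchanged r))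
      ; at-lvl = λ q r → at-lvl I q (proj₁ (unchanged r))
      ; cover = cover' ; upward = upward' ; level = level' }
      where
      glue-x : ∀ x → comp s (src x) ≡ nothing → comp s (tgt x) ≡ just b →
        comp s' (src (proj₁ x , true)) ≡ comp s' (tgt (proj₁ x , true))
      glue-x (_ , true)  q r = trans (cong (relabel b nothing) q) (sym (to-top r))
      glue-x (_ , false) q r = trans (to-top r) (sym (cong (relabel b nothing) q))
      bottom' : ∀ z → Σ Label λ d → comp s' (z , 0ℤ) ≡ just d × ht s d ≡ 0
      bottom' z with bottom I z
      -- A bottom cluster has height 0, so `reach` and `p < N` show that it is not `b`.
      ... | d , q , h = d , stay q (λ { refl → <⇒≱ p<N (subst (λ k → N ≤ k + p) h (reach x o src≡top tgt≡b)) }) , h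
      cover' : ∀ {y a} → Open (e ∷ X) y → comp s' (src y) ≡ just a → comp s' (tgt y) ≢ just a →
        y ∈ [] ⊎ y ∈ ups s a ⊎ y ∈ lvl s a
      cover' {y} o q r with open-tail {x = y} o | unchanged q
      ... | o' , _ | q' , a≢b = cover I o' q' (λ t → r (stay t a≢b))
      raised : ∀ {y a} → Open (e ∷ X) y → comp s (src y) ≡ just a → a ≢ b → comp s (tgt y) ≡ just b →
        opp y ∈ K' ⊎ (ht s a ≡ N × Right (opp y))
      raised {y} {a} o q a≢b r with open-tail {x = y} o
      ... | o' , y≢e with just-≢ (trans (tgt-opp s y) q) a≢b
      ...   | w with free (open-opp {x = y} o') r w
      ...     | inj₁ u = inj₁ (claimU y≢e u)
      ...     | inj₂ u with claimR y≢e u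
      ...       | inj₁ k = inj₁ k
      ...       | inj₂ b≡N with level I (open-opp {x = y} o') r w u
      ...         | _ , inj₁ (t , _) = contradiction (trans (tgt-opp s y) q) (nothing-≢ t)
      ...         | rt , inj₂ (g , t , _ , h) with just-injective (trans (sym t) (trans (tgt-opp s y) q)) | h b≡N
      ...           | refl | inj₁ a≡N = inj₂ (a≡N , rt b≡N)
      upward' : ∀ {y a} → Open (e ∷ X) y → comp s' (src y) ≡ just a → comp s' (tgt y) ≢ just a →
        y ∈ ups s a → Upward K' s' a y
      upward' {y} {a} o q r y∈a with open-tail {x = y} o | unchanged q
      ... | o' , y≢e | q' , a≢b with upward I o' q' (λ t → r (stay t a≢b)) y∈a
      ...   | inj₁ h = inj₁ h
      ...   | inj₂ (inj₁ (t , k)) = inj₂ (inj₁ (cong (relabel b nothing) t , keepK y≢e k))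
      ...   | inj₂ (inj₂ (g , t , h)) with g ≟ᴸ b
      ...     | no g≢b = inj₂ (inj₂ (g , stay t g≢b , h))
      ...     | yes refl with raised {y} o q' a≢b t
      ...       | inj₁ k = inj₂ (inj₁ (to-top t , k))
      ...       | inj₂ (a≡N , _) = inj₁ a≡N
      level' : ∀ {y a} → Open (e ∷ X) y → comp s' (src y) ≡ just a → comp s' (tgt y) ≢ just a →
        y ∈ lvl s a → Level K' [] s' a y
      level' {y} {a} o q r y∈a with open-tail {x = y} o | unchanged q
      ... | o' , y≢e | q' , a≢b with level I o' q' (λ t → r (stay t a≢b)) y∈a
      ...   | rt , inj₁ (t , k) = rt , inj₁ (cong (relabel b nothing) t , keepK y≢e k)
      ...   | rt , inj₂ (g , t , h) with g ≟ᴸ b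
      ...     | no g≢b = rt , inj₂ (g , stay t g≢b , h)
      ...     | yes refl with raised {y} o q' a≢b t
      ...       | inj₁ k = rt , inj₁ (to-top t , k)
      -- The spared edge would be level from both sides at height `N`, hence point right in both
      -- directions.
      ...       | inj₂ (a≡N , ro) = contradiction ro (Right-asym y (rt a≡N))

    -- A cluster newly touching the top touched `b` before, and lies at most 1 below it.
    reach' : Reach (e ∷ X) s' (suc p)
    reach' y {d} oy q r with open-tail {x = y} oy | unchanged r | relabel⁻¹-nothing (comp s (src y)) q
    ... | o' , _ | r' , _ | inj₁ q' = ≤-trans (reach y o' q' r') (+-monoʳ-≤ (ht s d) (n≤1+n p))
    ... | o' , _ | r' , d≢b | inj₂ q' = below (free (open-opp {x = y} o') r' tgt≢d)
      where
      tgt≡b' : comp s (tgt (opp y)) ≡ just b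
      tgt≡b' = trans (tgt-opp s y) q'
      tgt≢d : comp s (tgt (opp y)) ≢ just d
      tgt≢d = just-≢ tgt≡b' (d≢b ∘ sym)
      step≤ : ht s b ≤ suc (ht s d) → N ≤ ht s d + suc p
      step≤ h = begin
        N                    ≤⟨ reach x o src≡top tgt≡b ⟩
        ht s b + p           ≤⟨ +-monoˡ-≤ p h ⟩
        suc (ht s d) + p     ≡⟨ sym (+-suc (ht s d) p) ⟩
        ht s d + suc p       ∎
        where open ≤-Reasoning
      below : opp y ∈ ups s d ⊎ opp y ∈ lvl s d → N ≤ ht s d + suc p
      below (inj₁ u) with upward I (open-opp {x = y} o') r' tgt≢d u
      ... | inj₁ d≡N = ≤-trans (≤-reflexive (sym d≡N)) (m≤m+n _ _)
      ... | inj₂ (inj₁ (t , _)) = contradiction tgt≡b' (nothing-≢ t)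
      ... | inj₂ (inj₂ (g , t , h , _)) with just-injective (trans (sym t) tgt≡b')
      ...   | refl = step≤ h
      below (inj₂ u) with level I (open-opp {x = y} o') r' tgt≢d u
      ... | _ , inj₁ (t , _) = contradiction tgt≡b' (nothing-≢ t)
      ... | _ , inj₂ (g , t , h , _) with just-injective (trans (sym t) tgt≡b')
      ...   | refl = step≤ (m≤n⇒m≤1+n h)

    Joined : Set
    Joined = Σ (List HalfEdge) λ K' → Inv (e ∷ X) (e ∷ V) K' [] s' × length K' ≤ length K₁ + 2

    tgt-opp≢b : comp s (tgt (opp x)) ≢ just b
    tgt-opp≢b = nothing-≢ (trans (tgt-opp s x) src≡top)

    opp-free : opp x ∈ ups s b ⊎ opp x ∈ lvl s b
    opp-free = free (open-opp {x = x} o) tgt≡b tgt-opp≢b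

    -- If `x` was pending, one place becomes free and `b` has at most three half-edges besides
    -- `opp x`. If not, `Upward` and `Level` leave only one possibility: `b` has height `N` and
    -- `opp x` is upward. Then at most two other upward half-edges are claimed and the level one is
    -- spared.
    joined : Joined
    joined with x ∈ᴴ? K₁
    ... | yes x∈K = K ++ R ++ U ,
      join (λ ne q → ∈-++⁺ˡ (∈-without⁺ ne q))
           (λ ne q → ∈-++⁺ʳ K (∈-++⁺ʳ R (∈-without⁺ ne q)))
           (λ ne q → inj₁ (∈-++⁺ʳ K (∈-++⁺ˡ (∈-without⁺ ne q)))) ,
      length-++-budget K (R ++ U) 1 (length-without-< x∈K) (rest≤3 (size I b) opp-free)
      where
      rest≤3 : Size s b → opp x ∈ ups s b ⊎ opp x ∈ lvl s b → length (R ++ U) ≤ 3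
      rest≤3 (inj₁ (_ , q , r)) (inj₁ u) =
        length-++-≤ R U (≤-trans (length-without e (lvl s b)) r) (≤-pred (≤-trans (length-without-< u) q))
      rest≤3 (inj₂ (_ , q , r)) (inj₁ u) =
        length-++-≤ R U (≤-trans (length-without e (lvl s b)) r) (≤-pred (≤-trans (length-without-< u) q))
      rest≤3 (inj₁ (_ , q , r)) (inj₂ u) =
        length-++-≤ R U (≤-pred (≤-trans (length-without-< u) r)) (≤-trans (length-without e (ups s b)) q)
      rest≤3 (inj₂ (_ , q , r)) (inj₂ u) =
        length-++-≤ R U (≤-pred (≤-trans (length-without-< u) r)) (≤-trans (length-without e (ups s b)) q)
    ... | no x∉K with opp-free
    ...   | inj₂ u with level I (open-opp {x = x} o) tgt≡b tgt-opp≢b u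
    ...     | _ , inj₁ (_ , k) = contradiction (subst (_∈ K₁) (opp-involutive x) k) x∉K
    ...     | _ , inj₂ (g , t , _) = contradiction t (nothing-≢ (trans (tgt-opp s x) src≡top))
    joined | no x∉K | inj₁ u with upward I (open-opp {x = x} o) tgt≡b tgt-opp≢b u
    ...     | inj₂ (inj₁ (_ , k)) = contradiction (subst (_∈ K₁) (opp-involutive x) k) x∉K
    ...     | inj₂ (inj₂ (g , t , _)) = contradiction t (nothing-≢ (trans (tgt-opp s x) src≡top))
    ...     | inj₁ b≡N = K ++ U ,
      join (λ ne q → ∈-++⁺ˡ (∈-without⁺ ne q)) (λ ne q → ∈-++⁺ʳ K (∈-without⁺ ne q)) (λ _ _ → inj₂ b≡N) ,
      length-++-budget K U 0 (length-without e K₁)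
        (≤-pred (≤-trans (length-without-< u) ([ proj₁ ∘ proj₂ , (λ (_ , q , _) → ≤-trans q (s≤s z≤n)) ]′ (size I b))))

  -- One full turn of the game.

  -- The conditions concern open half-edges only. Further claims by H therefore do no harm, and
  -- pending lists can be emptied once their edges are claimed.
  settle : ∀ {X X' V V' K₁ K₁' K₂ K₂' s} → Inv X V K₁ K₂ s → (∀ {e} → e ∈ X → e ∈ X') →
    (∀ {e} → e ∈ V' → comp s (src (e , true)) ≡ comp s (tgt (e , true))) →
    (∀ {x} → Open X' x → x ∈ K₁ → x ∈ K₁') → (∀ {x} → Open X' x → x ∈ K₂ → x ∈ K₂') →
    Inv X' V' K₁' K₂' s
  settle I X⊆X' glue' f g = record
    { glue = glue' ; bottom = bottom I ; top = top I ; ht≤N = ht≤N I ; size = size I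
    ; at-ups = at-ups I ; at-lvl = at-lvl I
    ; cover = λ {x} o p q → Sum.map₁ (g {x} o) (cover I (shrink {x} o) p q)
    ; upward = λ {x} o p q r → Sum.map₂ (Sum.map₁ (λ (t , k) → t , f {opp x} o k)) (upward I (shrink {x} o) p q r)
    ; level = λ {x} o p q r → let rt , h = level I (shrink {x} o) p q r in
        rt , Sum.map (λ (t , k) → t , f {opp x} o k) (λ (b , t , h≤ , z) → b , t , h≤ , Sum.map₂ (g {opp x} o) ∘ z) h }
    where
    shrink : ∀ {x} → Open _ x → Open _ x
    shrink (v , ∉X) = v , ∉X ∘ X⊆X'

  Pure : State → Edge → Set
  Pure s e = (comp s (src (e , true)) ≡ nothing × comp s (tgt (e , true)) ≡ nothing)
           ⊎ (∃ λ a → ∃ λ b → comp s (src (e , true)) ≡ just a × comp s (tgt (e , true)) ≡ just b)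

  merge-one : ∀ {X V K₁ K₂ s} e → Inv X V K₁ K₂ s → ValidEdge n e → (e ∈ X → e ∈ V) → Pure s e →
    Merged X V K₁ K₂ s e
  merge-one {X} {V} {K₁} {K₂} {s} e I v X→V pure = go pure
    where
    skip : comp s (src (e , true)) ≡ comp s (tgt (e , true)) → Merged X V K₁ K₂ s e
    skip eq = K₂ , s , settle I there (λ { (here refl) → eq ; (there p) → glue I p }) (λ _ → id) (λ _ → id) ,
      m≤m+n _ _ , λ _ → id , λ p → _ , p
    go : Pure s e → Merged X V K₁ K₂ s e
    go (inj₁ (p , q)) = skip (trans p (sym q))
    go (inj₂ (a , b , p , q)) with a ≟ᴸ b
    ... | yes refl = skip (trans p (sym q))
    -- Were `e` claimed before, it would lie in `V`, and `glue` would put its ends in one cluster.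
    ... | no a≢b with (v , (λ e∈X → just-≢ q (a≢b ∘ sym) (trans (sym (glue I (X→V e∈X))) p)))
    ...   | o with <-cmp (ht s a) (ht s b)
    ...     | tri< a<b _ _ = merge-up {x = e , true} I o p q a<b
    ...     | tri≈ _ a≡b _ = merge-flat {x = e , true} I o p q a≢b a≡b
    ...     | tri> _ _ b<a = merge-up {x = e , false} I o q p b<a

  merge-all : ∀ {X V K₁ K₂ s} es → Inv X V K₁ K₂ s →
    (∀ {e} → e ∈ es → ValidEdge n e × (e ∈ X → e ∈ V) × Pure s e) →
    Σ (List HalfEdge) λ K → Σ State λ s' →
      Inv (es ++ X) (es ++ V) K₁ K s' × length K ≤ length K₂ + length es * 2 × SameTop s s'
  merge-all [] I _ = _ , _ , I , m≤m+n _ _ , λ _ → id , λ p → _ , p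
  merge-all {X} {V} {K₂ = K₂} {s} (e ∷ es) I ok with merge-all es I (ok ∘ there) | ok (here refl)
  ... | K , s₁ , I₁ , K≤ , same | v , X→V , pure with merge-one e I₁ v X→V' pure'
    where
    X→V' : e ∈ es ++ X → e ∈ es ++ V
    X→V' p = [ ∈-++⁺ˡ , ∈-++⁺ʳ es ∘ X→V ]′ (∈-++⁻ es p)
    pure' : Pure s₁ e
    pure' = Sum.map (λ (p , q) → proj₁ (same _) p , proj₁ (same _) q)
      (λ (a , b , p , q) → let a' , p' = proj₂ (same _) p ; b' , q' = proj₂ (same _) q in a' , b' , p' , q') pure
  ...   | K' , s₂ , I₂ , K'≤ , same' = K' , s₂ , I₂ , bound ,
    λ v → proj₁ (same' v) ∘ proj₁ (same v) , λ p → proj₂ (same' v) (proj₂ (proj₂ (same v) p))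
    where
    bound : length K' ≤ length K₂ + (2 + length es * 2)
    bound = begin
      length K'                          ≤⟨ K'≤ ⟩
      length K + 2                       ≤⟨ +-monoˡ-≤ 2 K≤ ⟩
      length K₂ + length es * 2 + 2      ≡⟨ +-assoc (length K₂) _ 2 ⟩
      length K₂ + (length es * 2 + 2)    ≡⟨ cong (λ k → length K₂ + k) (+-comm _ 2) ⟩
      length K₂ + (2 + length es * 2)    ∎
      where open ≤-Reasoning

  classify : ∀ s e → Pure s e ⊎ (Σ HalfEdge λ x → proj₁ x ≡ e × comp s (src x) ≡ nothing × (∃ λ b → comp s (tgt x) ≡ just b))
  classify s e with comp s (src (e , true)) in p | comp s (tgt (e , true)) in q
  ... | nothing | nothing = inj₁ (inj₁ (refl , refl))
  ... | just a  | just b  = inj₁ (inj₂ (a , b , refl , refl))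
  ... | nothing | just b  = inj₂ ((e , true) , refl , p , b , q)
  ... | just a  | nothing = inj₂ ((e , false) , refl , q , a , p)

  pick : ∀ s es → (∀ {e} → e ∈ es → Pure s e) ⊎
    (Σ HalfEdge λ x → Σ (List Edge) λ es' → es ↭ proj₁ x ∷ es' × comp s (src x) ≡ nothing × (∃ λ b → comp s (tgt x) ≡ just b))
  pick s [] = inj₁ λ ()
  pick s (e ∷ es) with classify s e | pick s es
  ... | inj₂ (x , refl , h) | _ = inj₂ (x , es , ↭-refl , h)
  ... | inj₁ _ | inj₂ (x , es' , σ , h) = inj₂ (x , e ∷ es' , ↭-trans (prep e σ) (swap e (proj₁ x) ↭-refl) , h)
  ... | inj₁ p | inj₁ q = inj₁ λ { (here refl) → p ; (there r) → q r }

  join-one : ∀ {X V K₁ s p x b} → Inv X V K₁ [] s → Reach X s p → p < N → Open X x →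
    comp s (src x) ≡ nothing → comp s (tgt x) ≡ just b →
    Σ (List HalfEdge) λ K → Σ State λ s' →
      Inv (proj₁ x ∷ X) (proj₁ x ∷ V) K [] s' × Reach (proj₁ x ∷ X) s' (suc p) × length K ≤ length K₁ + 2
  join-one {x = x} I reach p<N o t u = let K , I' , K≤ = joined in K , _ , I' , reach' , K≤
    where open Joining I {x} o reach t u p<N

  -- Edges meeting the top cluster come first, while every other cluster still has its old height and all its
  -- free half-edges.
  join-all : ∀ {U V} k es done {K₁ s} → length es ≡ k → Inv (done ++ U) (done ++ V) K₁ [] s →
    Reach (done ++ U) s (length done) → length done + length es ≤ N → length K₁ ≤ length done * 2 →
    (∀ {e} → e ∈ es → ValidEdge n e × e ∉ U) →
    Σ (List Edge) λ es' → Σ (List Edge) λ done' → Σ (List HalfEdge) λ K → Σ State λ s' →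
      es' ++ done' ↭ es ++ done × Inv (done' ++ U) (done' ++ V) K [] s' ×
      length K ≤ length done' * 2 × (∀ {e} → e ∈ es' → Pure s' e)
  join-all {U} {V} k es done {K₁} {s} |es| I reach ≤N K≤ ok with pick s es
  ... | inj₁ pure = es , done , K₁ , s , ↭-refl , I , K≤ , pure
  -- The remaining list is a rearrangement and no subterm of `es`, so the recursion runs on the
  -- length `k`.
  ... | inj₂ (x , es' , σ , p , b , q) = go k (trans (sym |es|) (↭-length σ))
    where
    x∈es : proj₁ x ∈ es
    x∈es = ∈-resp-↭ (↭-sym σ) (here refl)
    not-glued : ∀ x → comp s (src (proj₁ x , true)) ≡ comp s (tgt (proj₁ x , true)) →
      comp s (src x) ≡ nothing → comp s (tgt x) ≢ just b
    not-glued (_ , true)  g p = nothing-≢ (trans (sym g) p)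
    not-glued (_ , false) g p = nothing-≢ (trans g p)
    o : Open (done ++ U) x
    o = proj₁ (ok x∈es) , λ r → [ (λ r → not-glued x (glue I (∈-++⁺ˡ r)) p q) , proj₂ (ok x∈es) ]′ (∈-++⁻ done r)
    -- The chosen edge was not yet counted in `done`, hence `length done < N`, as `join-one`
    -- requires to keep the bottom off the top.
    ≤N' : suc (length done) + length es' ≤ N
    ≤N' = subst (_≤ N) (trans (cong (λ k → length done + k) (↭-length σ)) (+-suc (length done) (length es'))) ≤N
    go : ∀ k → k ≡ suc (length es') → Σ (List Edge) λ es' → Σ (List Edge) λ done' → Σ (List HalfEdge) λ K → Σ State λ s' →
      es' ++ done' ↭ es ++ done × Inv (done' ++ U) (done' ++ V) K [] s' ×
      length K ≤ length done' * 2 × (∀ {e} → e ∈ es' → Pure s' e)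
    go (suc k) eq with join-one {x = x} I reach (≤-trans (m≤m+n _ _) ≤N') o p q
    ... | K , s' , I' , reach' , K≤' with join-all k es' (proj₁ x ∷ done) (sym (suc-injective eq)) I' reach' ≤N'
      (≤-trans K≤' (≤-trans (+-monoˡ-≤ 2 K≤) (≤-reflexive (+-comm _ 2)))) (ok ∘ ∈-resp-↭ (↭-sym σ) ∘ there)
    ...   | es″ , done' , K' , s″ , τ , rest =
      es″ , done' , K' , s″ , ↭-trans τ (↭-trans (shift (proj₁ x) es' done) (++⁺ʳ done (↭-sym σ))) , rest

  -- Joins cost two places of `K₁` per edge and merges two of `K₂`, which adds up to the size of H's
  -- reply.
  turn : ∀ {U V s} es → Inv U V [] [] s → length es ≤ N → (∀ {e} → e ∈ es → ValidEdge n e × e ∉ U) →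
    Σ (List Edge) λ done → Σ (List HalfEdge) λ K₁ → Σ (List HalfEdge) λ K₂ → Σ State λ s' →
      done ↭ es × Inv (done ++ U) (done ++ V) K₁ K₂ s' × length (K₁ ++ K₂) ≤ 2 * length es
  turn {U} {V} {s} es I ≤N ok with join-all (length es) es [] refl I reach₀ ≤N z≤n ok
    where
    -- With nothing pending, only clusters of height `N` have open edges to the top.
    reach₀ : Reach U s 0
    reach₀ y {d} o p q with cover I {opp y} (open-opp {x = y} o) q (nothing-≢ (trans (tgt-opp s y) p))
    ... | inj₂ (inj₁ u) with upward I {opp y} (open-opp {x = y} o) q (nothing-≢ (trans (tgt-opp s y) p)) u
    ...   | inj₁ d≡N = ≤-reflexive (trans (sym d≡N) (sym (+-identityʳ _)))
    ...   | inj₂ (inj₂ (g , t , _)) = contradiction t (nothing-≢ (trans (tgt-opp s y) p))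
    reach₀ y {d} o p q | inj₂ (inj₂ u) with level I {opp y} (open-opp {x = y} o) q (nothing-≢ (trans (tgt-opp s y) p)) u
    ...   | _ , inj₂ (g , t , _) = contradiction t (nothing-≢ (trans (tgt-opp s y) p))
  ... | es' , done , K₁ , s₁ , σ , I₁ , K₁≤ , pure with merge-all es' I₁ ok'
    where
    ok' : ∀ {e} → e ∈ es' → ValidEdge n e × (e ∈ done ++ U → e ∈ done ++ V) × Pure s₁ e
    ok' {e} e∈ = proj₁ valid-open , (λ r → [ ∈-++⁺ˡ , (λ e∈U → contradiction e∈U (proj₂ valid-open)) ]′ (∈-++⁻ done r)) , pure e∈
      where
      valid-open : ValidEdge n e × e ∉ U
      valid-open = ok ([ id , (λ ()) ]′ (∈-++⁻ es (∈-resp-↭ σ (∈-++⁺ˡ e∈))))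
  ...   | K₂ , s₂ , I₂ , K₂≤ , _ =
    es' ++ done , K₁ , K₂ , s₂ , σ' ,
    subst₂ (λ X V → Inv X V K₁ K₂ s₂) (sym (++-assoc es' done U)) (sym (++-assoc es' done V)) I₂ , bound
    where
    σ' : es' ++ done ↭ es
    σ' = subst (es' ++ done ↭_) (++-identityʳ es) σ
    bound : length (K₁ ++ K₂) ≤ 2 * length es
    bound = begin
      length (K₁ ++ K₂)                     ≤⟨ length-++-≤ K₁ K₂ K₁≤ K₂≤ ⟩
      length done * 2 + length es' * 2      ≡⟨ sym (*-distribʳ-+ 2 (length done) (length es')) ⟩
      (length done + length es') * 2        ≡⟨ cong (_* 2) (+-comm (length done) (length es')) ⟩
      (length es' + length done) * 2        ≡⟨ cong (_* 2) (sym (length-++ es')) ⟩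
      length (es' ++ done) * 2              ≡⟨ cong (_* 2) (↭-length σ') ⟩
      length es * 2                         ≡⟨ *-comm (length es) 2 ⟩
      2 * length es                         ∎
      where open ≤-Reasoning

  -- The starting position.

  comp₀ : DualVertex → Maybe Label
  comp₀ v with proj₂ v ℤ.≟ + n
  ... | yes _ = nothing
  ... | no  _ = just v

  comp₀⁻¹ : ∀ {v a} → comp₀ v ≡ just a → a ≡ v
  comp₀⁻¹ {v} p with proj₂ v ℤ.≟ + n
  comp₀⁻¹ refl | no _ = refl

  comp₀-top : ∀ x → comp₀ (x , + n) ≡ nothing
  comp₀-top x with + n ℤ.≟ + n
  ... | yes _ = refl
  ... | no ne = contradiction refl ne

  comp₀-≤N : ∀ {x y} → y ≤ N → comp₀ (x , + y) ≡ just (x , + y)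
  comp₀-≤N {y = y} y≤N with + y ℤ.≟ + n
  ... | yes refl = contradiction y≤N (<⇒≱ ≤-refl)
  ... | no _ = refl

  -- The half-edges leaving the dual vertex `(x , + y)`. The dual of `ver x y` ends there from the
  -- left, so the one to the right has index `1ℤ ℤ.+ x`.
  up down left right : ℤ → ℕ → HalfEdge
  up    x y = hor x (suc y) , true
  down  x y = hor x y , false
  left  x y = ver x y , false
  right x y = ver (1ℤ ℤ.+ x) y , true

  -- Rows below 0 meet no valid edge, so the values there are immaterial.
  ht₀ : Label → ℕ
  ht₀ (x , + y)      = y ⊓ N
  ht₀ (x , -[1+ _ ]) = N

  -- In row `N` the left and down half-edges are filed as upward, where height `N` imposes no
  -- condition; the only level one then points right.
  ups₀ lvl₀ : Label → List HalfEdge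
  ups₀ (x , + y) with y <? N
  ... | yes _ = up x y ∷ []
  ... | no  _ = up x y ∷ left x y ∷ down x y ∷ []
  ups₀ (x , -[1+ _ ]) = []
  lvl₀ (x , + y) with y <? N
  ... | yes _ = left x y ∷ right x y ∷ down x y ∷ []
  ... | no  _ = right x y ∷ []
  lvl₀ (x , -[1+ _ ]) = []

  initial : State
  initial = record { comp = comp₀ ; ht = ht₀ ; ups = ups₀ ; lvl = lvl₀ }

  1+x-1 : ∀ x → 1ℤ ℤ.+ x ℤ.- 1ℤ ≡ x
  1+x-1 x = trans (cong (ℤ._- 1ℤ) (ℤ.+-comm 1ℤ x)) (trans (ℤ.+-assoc x 1ℤ (ℤ.- 1ℤ)) (ℤ.+-identityʳ x))

  1+[x-1] : ∀ x → 1ℤ ℤ.+ (x ℤ.- 1ℤ) ≡ x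
  1+[x-1] x = trans (sym (ℤ.+-assoc 1ℤ x (ℤ.- 1ℤ))) (1+x-1 x)

  initial-Inv : Inv [] [] [] [] initial
  initial-Inv = record
    { glue = λ () ; bottom = λ x → (x , 0ℤ) , comp₀-≤N z≤n , refl ; top = comp₀-top
    ; ht≤N = ht₀≤N ; size = size₀
    ; at-ups = λ {x} {a} p q → trans (comp₀⁻¹ q) (ups₀-src a p)
    ; at-lvl = λ {x} {a} p q → trans (comp₀⁻¹ q) (lvl₀-src a p)
    ; cover = λ { {x} (v , _) p _ → inj₂ (subst (λ a → x ∈ ups₀ a ⊎ x ∈ lvl₀ a) (sym (comp₀⁻¹ {src x} p)) (cover₀ x v)) }
    ; upward = λ {x} {a} _ _ _ → upward₀ x a
    ; level = λ {x} {a} o _ _ → level₀ x a (proj₁ o) }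
    where
    ht₀≤N : ∀ a → ht₀ a ≤ N
    ht₀≤N (x , + y)      = m⊓n≤n y N
    ht₀≤N (x , -[1+ _ ]) = ≤-refl
    size₀ : ∀ a → Size initial a
    size₀ (x , + y) with y <? N
    ... | yes y<N = inj₂ (≤-<-trans (m⊓n≤m y N) y<N , ≤-refl , ≤-refl)
    ... | no y≮N  = inj₁ (m≥n⇒m⊓n≡n (≮⇒≥ y≮N) , ≤-refl , ≤-refl)
    size₀ (x , -[1+ _ ]) = inj₁ (refl , z≤n , z≤n)
    ups₀-src : ∀ a {x} → x ∈ ups₀ a → src x ≡ a
    ups₀-src (x , + y) p with y <? N
    ups₀-src (x , + y) (here refl) | yes _ = refl
    ups₀-src (x , + y) (here refl) | no _ = refl
    ups₀-src (x , + y) (there (here refl)) | no _ = refl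
    ups₀-src (x , + y) (there (there (here refl))) | no _ = refl
    lvl₀-src : ∀ a {x} → x ∈ lvl₀ a → src x ≡ a
    lvl₀-src (x , + y) p with y <? N
    lvl₀-src (x , + y) (here refl) | yes _ = refl
    lvl₀-src (x , + y) (there (here refl)) | yes _ = cong (_, + y) (1+x-1 x)
    lvl₀-src (x , + y) (there (there (here refl))) | yes _ = refl
    lvl₀-src (x , + y) (here refl) | no _ = cong (_, + y) (1+x-1 x)
    cover₀ : ∀ x → ValidEdge n (proj₁ x) → x ∈ ups₀ (src x) ⊎ x ∈ lvl₀ (src x)
    cover₀ (hor x (suc y) , true) v with y <? N
    ... | yes _ = inj₁ (here refl)
    ... | no _  = inj₁ (here refl)
    cover₀ (hor x y , false) v with y <? N
    ... | yes _ = inj₂ (there (there (here refl)))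
    ... | no _  = inj₁ (there (there (here refl)))
    cover₀ (ver x y , true) v with y <? N
    ... | yes _ = inj₂ (there (here (cong (λ z → ver z y , true) (sym (1+[x-1] x)))))
    ... | no _  = inj₂ (here (cong (λ z → ver z y , true) (sym (1+[x-1] x))))
    cover₀ (ver x y , false) v with y <? N
    ... | yes _ = inj₂ (here refl)
    ... | no _  = inj₁ (there (here refl))
    upward₀ : ∀ x a → x ∈ ups₀ a → Upward [] initial a x
    upward₀ _ (x , + y) p with y <? N
    upward₀ _ (x , + y) p | no y≮N = inj₁ (m≥n⇒m⊓n≡n (≮⇒≥ y≮N))
    upward₀ _ (x , + y) (here refl) | yes y<N =
      inj₂ (inj₂ ((x , + suc y) , comp₀-≤N y<N ,
        ≤-trans (m⊓n≤m (suc y) N) (s≤s (≤-reflexive (sym (m≤n⇒m⊓n≡m (<⇒≤ y<N))))) , λ _ ()))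
    level₀ : ∀ x a → ValidEdge n (proj₁ x) → x ∈ lvl₀ a → Level [] [] initial a x
    level₀ _ (x , + y) v p with y <? N
    level₀ _ (x , + y) v (here refl) | yes y<N =
      (λ h → contradiction h (<⇒≢ (≤-<-trans (m⊓n≤m y N) y<N))) ,
      inj₂ (_ , comp₀-≤N (<⇒≤ y<N) , ≤-refl , inj₁)
    level₀ _ (x , + y) v (there (here refl)) | yes y<N =
      (λ h → contradiction h (<⇒≢ (≤-<-trans (m⊓n≤m y N) y<N))) ,
      inj₂ (_ , comp₀-≤N (<⇒≤ y<N) , ≤-refl , inj₁)
    level₀ _ (x , + suc y) v (there (there (here refl))) | yes y<N =
      (λ h → contradiction h (<⇒≢ (≤-<-trans (m⊓n≤m (suc y) N) y<N))) ,
      inj₂ (_ , comp₀-≤N (<⇒≤ (<-trans (n<1+n y) y<N)) , ⊓-monoˡ-≤ N (n≤1+n y) ,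
        λ h → contradiction h (<⇒≢ (≤-<-trans (m⊓n≤m (suc y) N) y<N)))
    -- Validity gives `y ≤ N`, so the row is exactly `N` and the right neighbour is labelled, with
    -- the same height.
    level₀ _ (x , + y) (_ , s≤s y≤N) (here refl) | no _ = (λ _ → tt) , inj₂ (_ , comp₀-≤N y≤N , ≤-refl , inj₁)

  -- From the invariant to legal replies.

  -- By `glue` the cluster is constant along a dual path of V, while the bottom row is labelled and
  -- the top row is not.
  not-crossing : ∀ {X V K₁ K₂ s E} → Inv X V K₁ K₂ s → (∀ {e} → e ∈ E → e ∈ V) → ¬ Crossing n E
  not-crossing {s = s} {E} I E⊆V (ps , linked , _ , ((x , _) , h , refl) , ((y , _) , l , refl)) =
    let _ , p , _ = bottom I x in nothing-≢ (top I y) (trans (sym (constant ps linked h l)) p)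
    where
    along : ∀ {u v} → DualAdj E u v → comp s u ≡ comp s v
    along (e , e∈E , inj₁ eq) = subst₂ (λ u v → comp s u ≡ comp s v) (cong proj₁ eq) (cong proj₂ eq) (glue I (E⊆V e∈E))
    along (e , e∈E , inj₂ eq) = sym (subst₂ (λ u v → comp s u ≡ comp s v) (cong proj₁ eq) (cong proj₂ eq) (glue I (E⊆V e∈E)))
    constant : ∀ ps {u w} → Linked (DualAdj E) ps → head ps ≡ just u → last ps ≡ just w → comp s u ≡ comp s w
    constant (u ∷ []) _ refl refl = refl
    constant (u ∷ v ∷ ps) (a ∷ as) refl l = trans (along a) (constant (v ∷ ps) as refl l)

  bound : List Edge → ℕ
  bound []             = 0
  bound (hor x _ ∷ es) = ∣ x ∣ + bound es
  bound (ver _ _ ∷ es) = bound es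

  ≤-bound : ∀ {x y es} → hor x y ∈ es → ∣ x ∣ ≤ bound es
  ≤-bound (here refl) = m≤m+n _ _
  ≤-bound {es = hor x' _ ∷ _} (there p) = ≤-trans (≤-bound p) (m≤n+m _ ∣ x' ∣)
  ≤-bound {es = ver _ _ ∷ _} (there p) = ≤-bound p

  -- The strip is infinite, and `bound` is at least every `∣ x ∣` in the list, so the next edge of
  -- row 1 is new.
  fresh-edge : ∀ es → Σ Edge λ e → ValidEdge n e × e ∉ es
  fresh-edge es = hor (+ suc (bound es)) 1 , (s≤s z≤n , s≤s z≤n) , λ p → <⇒≱ (n<1+n _) (≤-bound p)

  FreshEdges-∷ : ∀ {used e es} → ValidEdge n e → e ∉ used → e ∉ es → FreshEdges n used es → FreshEdges n used (e ∷ es)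
  FreshEdges-∷ v e∉used e∉es (vs , u , fs) = v ∷ vs , All.tabulate (λ { q refl → e∉es q }) ∷ u , e∉used ∷ fs

  -- Pending lists may contain repetitions, edges outside the strip and edges claimed earlier, none
  -- of which a legal reply may contain.
  collect : ∀ used es → Σ (List Edge) λ r → FreshEdges n used r × length r ≤ length es ×
    (∀ {e} → e ∈ es → ValidEdge n e → e ∈ used ⊎ e ∈ r)
  collect used [] = [] , ([] , [] , []) , z≤n , λ ()
  collect used (e ∷ es) with collect used es | valid? n e | e ∈ᴱ? used
  ... | r , fr , r≤ , got | no ¬v | _ = r , fr , m≤n⇒m≤1+n r≤ , λ { (here refl) v → contradiction v ¬v ; (there p) → got p }
  ... | r , fr , r≤ , got | yes _ | yes u = r , fr , m≤n⇒m≤1+n r≤ , λ { (here refl) _ → inj₁ u ; (there p) → got p }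
  ... | r , fr , r≤ , got | yes v | no e∉used with e ∈ᴱ? r
  ...   | yes e∈r = r , fr , m≤n⇒m≤1+n r≤ , λ { (here refl) _ → inj₂ e∈r ; (there p) → got p }
  ...   | no e∉r = e ∷ r , FreshEdges-∷ v e∉used e∉r fr , s≤s r≤ ,
    λ { (here refl) _ → inj₂ (here refl) ; (there p) v' → Sum.map₂ there (got p v') }

  -- H must claim an exact number of edges; arbitrary fresh ones make up the difference.
  pad : ∀ used j r → FreshEdges n used r →
    Σ (List Edge) λ r' → FreshEdges n used r' × length r' ≡ j + length r × (∀ {e} → e ∈ r → e ∈ r')
  pad used zero r fr = r , fr , refl , id
  pad used (suc j) r fr with fresh-edge (used ++ r)
  ... | e , v , e∉ with pad used j (e ∷ r) (FreshEdges-∷ v (e∉ ∘ ∈-++⁺ˡ) (e∉ ∘ ∈-++⁺ʳ used) fr)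
  ...   | r' , fr' , |r'| , r⊆ = r' , fr' , trans |r'| (+-suc j (length r)) , r⊆ ∘ there

  respond : ∀ used es k → length es ≤ k → Σ (List Edge) λ r → length r ≡ k × FreshEdges n used r ×
    (∀ {e} → e ∈ es → ValidEdge n e → e ∈ used ⊎ e ∈ r)
  respond used es k es≤k with collect used es
  ... | r , fr , r≤ , got with pad used (k ∸ length r) r fr
  ...   | r' , fr' , |r'| , r⊆r' = r' , trans |r'| (m∸n+n≡m (≤-trans r≤ es≤k)) , fr' , λ p v → Sum.map₂ r⊆r' (got p v)

  claimed-∷ʳ : ∀ h m r → claimed (h ++ (m , r) ∷ []) ≡ claimed h ++ m ++ r
  claimed-∷ʳ h m r = begin
    claimed (h ++ (m , r) ∷ [])          ≡⟨ cong concat (map-++ _ h _) ⟩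
    concat (map _ h ++ (m ++ r) ∷ [])    ≡⟨ sym (concat-++ (map _ h) _) ⟩
    claimed h ++ (m ++ r) ++ []          ≡⟨ cong (claimed h ++_) (++-identityʳ (m ++ r)) ⟩
    claimed h ++ m ++ r                  ∎
    where open ≡-Reasoning

  claimedV-∷ʳ : ∀ h m r → claimedV (h ++ (m , r) ∷ []) ≡ claimedV h ++ m
  claimedV-∷ʳ h m r = begin
    claimedV (h ++ (m , r) ∷ [])         ≡⟨ cong concat (map-++ proj₁ h _) ⟩
    concat (map proj₁ h ++ m ∷ [])       ≡⟨ sym (concat-++ (map proj₁ h) _) ⟩
    claimedV h ++ m ++ []                ≡⟨ cong (claimedV h ++_) (++-identityʳ m) ⟩
    claimedV h ++ m                      ∎
    where open ≡-Reasoning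

  -- The strategy and its correctness.

  Safe : History → Set
  Safe h = Σ State (Inv (claimed h) (claimedV h) [] [])

  -- A decidable consequence of `LegalV` when `q ≤ N`, tested because a strategy must be defined on
  -- arbitrary input.
  Playable : History → List Edge → Set
  Playable h m = length m ≤ N × All (ValidEdge n) m × All (_∉ claimed h) m

  playable? : ∀ h m → Dec (Playable h m)
  playable? h m = (length m ≤? N) ×-dec All.all? (valid? n) m ×-dec All.all? (λ e → ¬? (e ∈ᴱ? claimed h)) m

  answer : ∀ h m → Safe h → Playable h m →
    Σ (List Edge) λ r → LegalH n h m r × ¬ Crossing n (claimedV h ++ m) × Safe (h ++ (m , r) ∷ [])
  answer h m (s , I) (m≤N , vs , fs) with turn m I m≤N (λ p → All.lookup vs p , All.lookup fs p)
  ... | done , K₁ , K₂ , s' , σ , I' , K≤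
    with respond (claimed h ++ m) (map proj₁ (K₁ ++ K₂)) (2 * length m) (subst (_≤ _) (sym (length-map proj₁ (K₁ ++ K₂))) K≤)
  ...   | r , |r| , fr , got = r , (|r| , fr) , not-crossing I' V⊆ , s' , I″
    where
    V⊆ : ∀ {e} → e ∈ claimedV h ++ m → e ∈ done ++ claimedV h
    V⊆ p = [ ∈-++⁺ʳ done , ∈-++⁺ˡ ∘ ∈-resp-↭ (↭-sym σ) ]′ (∈-++⁻ (claimedV h) p)
    X' : List Edge
    X' = claimed (h ++ (m , r) ∷ [])
    ⊆X' : ∀ {e} → e ∈ claimed h ++ m ⊎ e ∈ r → e ∈ X'
    ⊆X' {e} p = subst (e ∈_) (trans (++-assoc (claimed h) m r) (sym (claimed-∷ʳ h m r))) ([ ∈-++⁺ˡ , ∈-++⁺ʳ (claimed h ++ m) ]′ p)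
    taken : ∀ {x} → Open X' x → x ∉ K₁ ++ K₂
    taken (v , ∉X') p = ∉X' (⊆X' (got (∈-map⁺ proj₁ p) v))
    I″ : Inv X' (claimedV (h ++ (m , r) ∷ [])) [] [] s'
    I″ = settle I'
      (λ p → ⊆X' (inj₁ ([ ∈-++⁺ʳ (claimed h) ∘ ∈-resp-↭ σ , ∈-++⁺ˡ ]′ (∈-++⁻ done p))))
      (λ {e} p → glue I' (V⊆ (subst (e ∈_) (claimedV-∷ʳ h m r) p)))
      (λ {x} o p → contradiction (∈-++⁺ˡ p) (taken {x} o))
      (λ {x} o p → contradiction (∈-++⁺ʳ K₁ p) (taken {x} o))

  Position : Set
  Position = Σ History Safe

  reply : Position → List Edge → List Edge
  reply (h , safe) m with playable? h m
  ... | yes ok = proj₁ (answer h m safe ok)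
  ... | no _   = []

  advance : Position → List Edge → Position
  advance (h , safe) m with playable? h m
  ... | yes ok = h ++ (m , proj₁ (answer h m safe ok)) ∷ [] , proj₂ (proj₂ (proj₂ (answer h m safe ok)))
  -- Default for unplayable moves, which reachable histories do not contain.
  ... | no _   = h , safe

  advance-history : ∀ p m → Playable (proj₁ p) m → proj₁ (advance p m) ≡ proj₁ p ++ (m , reply p m) ∷ []
  advance-history (h , safe) m ok with playable? h m
  ... | yes _  = refl
  ... | no ¬ok = contradiction ok ¬ok

  reply-correct : ∀ p m → Playable (proj₁ p) m →
    ¬ Crossing n (claimedV (proj₁ p) ++ m) × LegalH n (proj₁ p) m (reply p m)
  reply-correct (h , safe) m ok with playable? h m
  ... | yes ok' = let _ , legal , ¬cross , _ = answer h m safe ok' in ¬cross , legal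
  ... | no ¬ok  = contradiction ok ¬ok

  -- The state is rebuilt from V's moves alone; on reachable histories the recomputed replies are
  -- the recorded ones.
  replay : History → Position
  replay = foldl (λ p t → advance p (proj₁ t)) ([] , initial , initial-Inv)

  strategy : HStrategy
  strategy h = reply (replay h)

  module _ {q : ℕ} (q≤N : q ≤ N) where

    playable : ∀ h m → LegalV n q h m → Playable h m
    playable h m (_ , m≤q , vs , _ , fs) = ≤-trans m≤q q≤N , vs , fs

    replay-history : ∀ {h} → Reachable n q strategy h → proj₁ (replay h) ≡ h
    replay-history start = refl
    replay-history (step {h} {m} reach legal) = begin
      proj₁ (replay (h ++ (m , strategy h m) ∷ []))           ≡⟨ cong proj₁ (foldl-∷ʳ _ _ (m , strategy h m) h) ⟩
      proj₁ (advance (replay h) m)                            ≡⟨ advance-history (replay h) m ok ⟩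
      proj₁ (replay h) ++ (m , strategy h m) ∷ []             ≡⟨ cong (_++ (m , strategy h m) ∷ []) (replay-history reach) ⟩
      h ++ (m , strategy h m) ∷ []                            ∎
      where
      open ≡-Reasoning
      ok : Playable (proj₁ (replay h)) m
      ok = subst (λ h → Playable h m) (sym (replay-history reach)) (playable h m legal)

    strategy-winning : HWinning n q strategy
    strategy-winning h m reach legal =
      subst (λ h' → ¬ Crossing n (claimedV h' ++ m) × LegalH n h' m (strategy h m)) (replay-history reach)
        (reply-correct (replay h) m (subst (λ h → Playable h m) (sym (replay-history reach)) (playable h m legal)))

theorem4p1 : (n q : ℕ) → suc q ≤ n → Σ HStrategy λ σ → HWinning n q σ
theorem4p1 (suc N) q (s≤s q≤N) = Strategy.strategy N , Strategy.strategy-winning N q≤N
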